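{- Let $t, r$ be integers with $1 \leq t \leq r$, let $k \geq 2$, and let $\mathcal{H}$ be a hereditary family with $\mu(\mathcal{H}) \geq \max\{n_{\rm S}(r,t), (k^{1/t}+1)r\}$. For each $i \in [k]$, let $\emptyset \neq S_i \subseteq [t,r]$ and $\mathcal{F}_i := \bigcup_{s \in S_i}\mathcal{H}^{(s)}$. Let $\mathcal{A}_1, \dots, \mathcal{A}_k$ be cross-$t$-intersecting families such that $\mathcal{A}_i \subseteq \mathcal{F}_i$ for all $i \in [k]$, and let $j \in [k]$ be such that $|\mathcal{F}_i| \leq |\mathcal{F}_j|$ for all $i \in [k]$. Then \[\sum_{i = 1}^k |\mathcal{A}_i| \leq |\mathcal{F}_j|,\] and equality holds if and only if, for some $l \in [k]$ such that $|\mathcal{F}_l| = |\mathcal{F}_j|$, $\mathcal{A}_l = \mathcal{F}_l$ and $\mathcal{A}_i = \emptyset$ for all $i \in [k] \setminus \{l\}$.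
   Context: All sets and families are finite. For integers $m \le n$, $[m,n] := \{i \in \{1,2,\dots\} : m \le i \le n\}$ and $[n] := [1,n]$. A family $\mathcal{H}$ is hereditary if every subset of every member of $\mathcal{H}$ is a member of $\mathcal{H}$. A base of a family $\mathcal{F}$ is a set $B \in \mathcal{F}$ that is not a proper subset of any member of $\mathcal{F}$; $\mu(\mathcal{F})$ denotes the size of a smallest base of $\mathcal{F}$. $\mathcal{H}^{(s)} := \{H \in \mathcal{H} : |H| = s\}$. A set $A$ $t$-intersects $B$ if $|A\cap B| \ge t$. Families $\mathcal{A}_1,\dots,\mathcal{A}_k$ are cross-$t$-intersecting if for all distinct $i,j \in [k]$, every set in $\mathcal{A}_i$ $t$-intersects every set in $\mathcal{A}_j$. Define $m(r,t) := \max\{2r, \frac{(r-t)(r-t+5)}{2} + (t-1)\}$ and $n_{\rm S}(r,t) := (r-t+1)\binom{m(r,t)}{t+1} + r$. -}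

module Defs where

open import Data.Bool using (Bool; true; false; _∧_)
open import Data.Nat using (ℕ; zero; suc; _+_; _*_; _∸_; _≤_; _⊔_; _≡ᵇ_)
open import Data.Nat.DivMod using (_/_)
open import Data.Nat.Combinatorics using (_C_)
open import Data.Fin using (Fin)
open import Data.Fin.Subset using (Subset; _⊆_; _⊂_; _∩_; ∣_∣)
open import Data.Vec using (_∷_; [])
open import Data.List using (List; []; _∷_; map; _++_; filter; length; tabulate)
open import Data.Nat.ListAction using (sum)
open import Relation.Binary.PropositionalEquality using (_≡_)
open import Relation.Nullary using (¬_)
open import Data.Bool.Properties using (T?)

Family : ℕ → Set
Family n = Subset n → Bool

allSubsets : (n : ℕ) → List (Subset n)
allSubsets zero = [] ∷ []
allSubsets (suc n) = map (true ∷_) (allSubsets n) ++ map (false ∷_) (allSubsets n)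

card : ∀ {n} → Family n → ℕ
card {n} F = length (filter (λ A → T? (F A)) (allSubsets n))

Hereditary : ∀ {n} → Family n → Set
Hereditary {n} H = (A B : Subset n) → B ⊆ A → H A ≡ true → H B ≡ true

IsBase : ∀ {n} → Family n → Subset n → Set
IsBase {n} F B = F B ≡ true × ((C : Subset n) → F C ≡ true → ¬ (B ⊂ C))
  where open import Data.Product using (_×_)

-- μ(F) ≥ c, i.e. the smallest base of F has size at least c
-- (every base has size ≥ c).
μ≥ : ∀ {n} → Family n → ℕ → Set
μ≥ {n} F c = (B : Subset n) → IsBase F B → c ≤ ∣ B ∣

level : ∀ {n} → Family n → ℕ → Family n
level H s A = H A ∧ (∣ A ∣ ≡ᵇ s)

levelUnion : ∀ {n} → Family n → (ℕ → Bool) → Family n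
levelUnion H S A = H A ∧ S ∣ A ∣

_⊆F_ : ∀ {n} → Family n → Family n → Set
_⊆F_ {n} A F = (X : Subset n) → A X ≡ true → F X ≡ true

_≐F_ : ∀ {n} → Family n → Family n → Set
_≐F_ {n} A F = (X : Subset n) → A X ≡ F X

EmptyF : ∀ {n} → Family n → Set
EmptyF {n} A = (X : Subset n) → A X ≡ false

_⟨_⟩-intersects_ : ∀ {n} → Subset n → ℕ → Subset n → Set
A ⟨ t ⟩-intersects B = t ≤ ∣ A ∩ B ∣

CrossIntersecting : ∀ {n k} → ℕ → (Fin k → Family n) → Set
CrossIntersecting {n} {k} t A =
  (i j : Fin k) → ¬ (i ≡ j) → (X Y : Subset n) → A i X ≡ true → A j Y ≡ true →
  X ⟨ t ⟩-intersects Y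

-- m(r,t) = max{2r, (r-t)(r-t+5)/2 + (t-1)}  (the product is always even)
m : ℕ → ℕ → ℕ
m r t = (2 * r) ⊔ (((r ∸ t) * (r ∸ t + 5)) / 2 + (t ∸ 1))

nS : ℕ → ℕ → ℕ
nS r t = (r ∸ t + 1) * (m r t C (t + 1)) + r

sumFin : ∀ {k} → (Fin k → ℕ) → ℕ
sumFin f = sum (tabulate f)

{-# OPTIONS --safe #-}
module Submission where

-- Write F(T) for the star of T in a family F = F_i, N = μ(H) − r and C = binom(r, t).
-- Exchanging y for a point of a base outside the set gives N |F(T ∪ {y})| ≤ (r − |T|) |F(T)| and
-- (N + r) |F(T ∪ {y})| ≤ r |F(T)|; hence (k + 1) |F(T)| ≤ |F| whenever |T| = t.
-- If at least two A_i are nonempty, every A_l cross-t-intersects a nonempty union B_l of the others.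
--  * If no B_l lies in the star of a t-set, then every X ∈ A_l contains a t-subset T of a fixed
--    member of B_l, and one further point of some Y ∈ B_l with T ⊈ Y. So A_l is covered by few
--    stars of (t+1)-sets, and (k + 1) |A_l| ≤ |F_l|.
--  * If all the A_i lie in one star, then (k + 1) |A_i| ≤ |F_i| as well.
--  * If B_l lies in the star of T but some X₀ ∈ A_l does not, then each A_i with i ≠ l is covered by
--    the stars of T ∪ {y}, y ∈ X₀ ∖ T, so 2 (k + 1) |A_i| ≤ |F_i|, while A_l is covered by C stars of
--    t-sets, so 2 |A_l| ≤ |F_l|.
-- The threshold n_S(r,t) enters only through N ≥ (r − t + 1) binom(2r, t + 1) ≥ (r − t + 1) r C.

open import Defs
open import Level using (Level)
open import Data.Bool using (Bool; true; false; if_then_else_)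
import Data.Bool as Bool
open import Data.Bool.Properties using (∧-conicalˡ; ∧-conicalʳ; ¬-not; T?)
open import Data.Unit using (tt) renaming (⊤ to Unit)
open import Data.Nat
open import Data.Nat.Properties
open import Data.Nat.Combinatorics using (_C_; nCn≡1; nCk+nC[k+1]≡[n+1]C[k+1])
open import Data.Nat.ListAction using (sum)
open import Data.Nat.Tactic.RingSolver using (solve-∀)
open import Data.Fin using (Fin; zero; suc)
import Data.Fin as Fin
import Data.Fin.Properties as Fin
open import Data.Fin.Subset using (Subset; ⊥; ∣_∣; inside; outside; _∈_; _∉_; _⊆_; _∩_)
open import Data.Fin.Subset.Properties
  using (_∈?_; _⊆?_; _⊂?_; anySubset?; nonempty?; Empty-unique; ∣p∣≤n; ∣⊥∣≡0; ∉⊥; p⊂q⇒∣p∣<∣q∣;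
         ⊆-antisym; drop-there; drop-∷-⊆; out⊆; in⊆in; x∈p∩q⁻)
open import Data.List using (List; []; _∷_; [_]; map; _++_; filter; length; allFin)
open import Data.List.Properties using (length-map; length-++; length-tabulate; map-tabulate)
open import Data.List.Membership.Propositional renaming (_∈_ to _∈ˡ_) using ()
open import Data.List.Membership.Propositional.Properties
  using (∈-map⁺; ∈-map⁻; ∈-++⁺ˡ; ∈-++⁺ʳ; ∈-++⁻; ∈-allFin)
open import Data.List.Relation.Unary.All as All using (All; []; _∷_)
open import Data.List.Relation.Unary.Any using (here; there)
open import Data.List.Relation.Unary.AllPairs using ([]; _∷_)
open import Data.List.Relation.Unary.Unique.Propositional using (Unique)
import Data.List.Relation.Unary.Unique.Propositional.Properties as Unique
open import Data.Vec using (_∷_; []; _[_]≔_; here; there)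
import Data.Vec.Properties as Vec
open import Data.Product using (_×_; _,_; ∃; ∃-syntax; proj₁; proj₂)
open import Data.Sum using (inj₁; inj₂)
open import Function using (_∘_; id)
open import Function.Bundles using (_⇔_; mk⇔)
open import Relation.Binary.Definitions using (DecidableEquality)
open import Relation.Binary.PropositionalEquality
  using (_≡_; _≢_; refl; sym; trans; cong; cong₂; subst)
open import Relation.Nullary using (¬_; Dec; yes; no; does; contradiction; ¬?; _×-dec_)
open import Relation.Nullary.Decidable using (decidable-stable)
open import Relation.Unary using (Decidable)

private
  variable
    a p q : Level
    A B : Set a
    P Q : A → Set p
    n : ℕ

-- Finite sums

∑ : List A → (A → ℕ) → ℕ
∑ xs f = sum (map f xs)

∑-mono : ∀ (xs : List A) {f g : A → ℕ} → (∀ {x} → x ∈ˡ xs → f x ≤ g x) → ∑ xs f ≤ ∑ xs g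
∑-mono []       f≤g = z≤n
∑-mono (x ∷ xs) f≤g = +-mono-≤ (f≤g (here refl)) (∑-mono xs (f≤g ∘ there))

∑-+ : ∀ (xs : List A) (f g : A → ℕ) → ∑ xs (λ x → f x + g x) ≡ ∑ xs f + ∑ xs g
∑-+ []       f g = refl
∑-+ (x ∷ xs) f g rewrite ∑-+ xs f g = lemma (f x) (g x) (∑ xs f) (∑ xs g)
  where
  lemma : ∀ a b c d → a + b + (c + d) ≡ a + c + (b + d)
  lemma = solve-∀

∑-* : ∀ c (xs : List A) (f : A → ℕ) → ∑ xs (λ x → c * f x) ≡ c * ∑ xs f
∑-* c []       f = sym (*-zeroʳ c)
∑-* c (x ∷ xs) f rewrite ∑-* c xs f = sym (*-distribˡ-+ c (f x) (∑ xs f))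

∑-const : ∀ (xs : List A) c → ∑ xs (λ _ → c) ≡ length xs * c
∑-const []       c = refl
∑-const (x ∷ xs) c = cong (c +_) (∑-const xs c)

∑-swap : ∀ (xs : List A) (ys : List B) (f : A → B → ℕ) →
         ∑ xs (λ x → ∑ ys (f x)) ≡ ∑ ys (λ y → ∑ xs (λ x → f x y))
∑-swap []       ys f = sym (trans (∑-const ys 0) (*-zeroʳ (length ys)))
∑-swap (x ∷ xs) ys f rewrite ∑-swap xs ys f = sym (∑-+ ys (f x) (λ y → ∑ xs (λ x → f x y)))

∈⇒≤∑ : ∀ {xs : List A} (f : A → ℕ) {x} → x ∈ˡ xs → f x ≤ ∑ xs f
∈⇒≤∑ f (here refl)         = m≤m+n _ _
∈⇒≤∑ f (there {x = y} x∈) = m≤n⇒m≤o+n (f y) (∈⇒≤∑ f x∈)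

𝟙 : {P : Set p} → Dec P → ℕ
𝟙 P? = if does P? then 1 else 0

𝟙-mono : {P : Set p} {Q : Set q} (P? : Dec P) (Q? : Dec Q) → (P → Q) → 𝟙 P? ≤ 𝟙 Q?
𝟙-mono (no _)  _        P⇒Q = z≤n
𝟙-mono (yes x) (yes _)  P⇒Q = ≤-refl
𝟙-mono (yes x) (no ¬q)  P⇒Q = contradiction (P⇒Q x) ¬q

1≤𝟙 : {P : Set p} (P? : Dec P) → P → 1 ≤ 𝟙 P?
1≤𝟙 (yes _) _ = ≤-refl
1≤𝟙 (no ¬x) x = contradiction x ¬x

𝟙*-≤ : ∀ {P : Set p} (P? : Dec P) {c m} → (P → c ≤ m) → 𝟙 P? * c ≤ m
𝟙*-≤ (yes x) {c} c≤m = ≤-trans (≤-reflexive (+-identityʳ c)) (c≤m x)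
𝟙*-≤ (no _)  c≤m = z≤n

∑𝟙≡0 : ∀ {xs : List A} (P? : Decidable P) → All (λ x → ¬ P x) xs → ∑ xs (𝟙 ∘ P?) ≡ 0
∑𝟙≡0 P? [] = refl
∑𝟙≡0 P? (_∷_ {x} ¬Px ¬P) with P? x
... | yes Px = contradiction Px ¬Px
... | no _   = ∑𝟙≡0 P? ¬P

-- `P` holds for at most one value and `xs` has no repetitions, so at most one summand is nonzero,
-- and it forces `R`. This bounds the fibres of an injection.
∑𝟙≤𝟙 : ∀ {xs : List A} (P? : Decidable P) {R : Set q} (R? : Dec R) → Unique xs →
       (∀ {x} → P x → R) → (∀ {x y} → P x → P y → x ≡ y) → ∑ xs (𝟙 ∘ P?) ≤ 𝟙 R?
∑𝟙≤𝟙 P? R? [] P⇒R P-unique = z≤n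
∑𝟙≤𝟙 P? R? (_∷_ {x} x≢ u) P⇒R P-unique with P? x
... | no _ = ∑𝟙≤𝟙 P? R? u P⇒R P-unique
... | yes Px rewrite ∑𝟙≡0 P? (All.map (λ x≢y Py → x≢y (P-unique Px Py)) x≢) = 1≤𝟙 R? (P⇒R Px)

-- An injection from P into Q is counted through its graph.
∑-injective : ∀ {xs : List A} {ys : List B} (P? : Decidable P) (Q? : Decidable Q) →
              DecidableEquality B → Unique xs → (∀ y → y ∈ˡ ys) →
              (φ : A → B) → (∀ {x} → P x → Q (φ x)) →
              (∀ {x y} → P x → P y → φ x ≡ φ y → x ≡ y) →
              ∑ xs (𝟙 ∘ P?) ≤ ∑ ys (𝟙 ∘ Q?)
∑-injective {xs = xs} {ys} P? Q? _≟_ u complete φ P⇒Q φ-inj = begin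
  ∑ xs (𝟙 ∘ P?)                           ≤⟨ ∑-mono xs (λ {x} _ → ≤-trans
                                               (𝟙-mono (P? x) (G? x (φ x)) (_, refl))
                                               (∈⇒≤∑ (𝟙 ∘ G? x) (complete (φ x)))) ⟩
  ∑ xs (λ x → ∑ ys (𝟙 ∘ G? x))            ≡⟨ ∑-swap xs ys (λ x y → 𝟙 (G? x y)) ⟩
  ∑ ys (λ y → ∑ xs (λ x → 𝟙 (G? x y)))    ≤⟨ ∑-mono ys (λ {y} _ → ∑𝟙≤𝟙 (λ x → G? x y) (Q? y) u
                                               (λ where (Px , refl) → P⇒Q Px)
                                               (λ where (Px , e) (Py , e′) →
                                                          φ-inj Px Py (trans e (sym e′)))) ⟩
  ∑ ys (𝟙 ∘ Q?)                           ∎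
  where
  open ≤-Reasoning
  G? : ∀ x y → Dec _
  G? x y = P? x ×-dec (φ x ≟ y)

sumFin≡∑ : ∀ {k} (f : Fin k → ℕ) → sumFin f ≡ ∑ (allFin k) f
sumFin≡∑ f = cong sum (sym (map-tabulate id f))

-- Arithmetic

-- A single factor `b` absorbs `c`, which is why `t` must be positive; the other factors only need
-- `a ≤ b`.
c*a^t≤b^t : ∀ c {a b t} → 1 ≤ t → c * a ≤ b → a ≤ b → c * a ^ t ≤ b ^ t
c*a^t≤b^t c {a} {b} {suc t} _ c*a≤b a≤b =
  ≤-trans (≤-reflexive (sym (*-assoc c a (a ^ t)))) (*-mono-≤ c*a≤b (^-monoˡ-≤ t a≤b))

-- Expand one factor of the power of `a + b` and bound the remaining factors below by `a` or `b`.
^-superadditive : ∀ a b {t} → 1 ≤ t → a ^ t + b ^ t ≤ (a + b) ^ t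
^-superadditive a b {suc t} _ = begin
  a * a ^ t + b * b ^ t              ≤⟨ +-mono-≤ (*-monoʳ-≤ a (^-monoˡ-≤ t (m≤m+n a b)))
                                                 (*-monoʳ-≤ b (^-monoˡ-≤ t (m≤n+m b a))) ⟩
  a * (a + b) ^ t + b * (a + b) ^ t  ≡⟨ *-distribʳ-+ ((a + b) ^ t) a b ⟨
  (a + b) * (a + b) ^ t              ∎
  where open ≤-Reasoning

nCk≤[1+n]Ck : ∀ n k → n C k ≤ suc n C k
nCk≤[1+n]Ck n zero    = ≤-refl
nCk≤[1+n]Ck n (suc k) = ≤-trans (m≤n+m _ (n C k)) (≤-reflexive (nCk+nC[k+1]≡[n+1]C[k+1] n k))

nCk-monoˡ-≤ : ∀ k {m n} → m ≤ n → m C k ≤ n C k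
nCk-monoˡ-≤ k = go ∘ ≤⇒≤′
  where
  go : ∀ {m n} → m ≤′ n → m C k ≤ n C k
  go ≤′-refl       = ≤-refl
  go (≤′-step m≤n) = ≤-trans (go m≤n) (nCk≤[1+n]Ck _ k)

1≤nCk : ∀ {k n} → k ≤ n → 1 ≤ n C k
1≤nCk {k} k≤n = ≤-trans (≤-reflexive (sym (nCn≡1 k))) (nCk-monoˡ-≤ k k≤n)

-- Choose k elements among the first a and one among the other b.
aCk*b≤[b+a]C[1+k] : ∀ a b k → (a C k) * b ≤ (b + a) C suc k
aCk*b≤[b+a]C[1+k] a zero    k = ≤-trans (≤-reflexive (*-zeroʳ (a C k))) z≤n
aCk*b≤[b+a]C[1+k] a (suc b) k = begin
  (a C k) * suc b                  ≡⟨ *-suc (a C k) b ⟩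
  (a C k) + (a C k) * b            ≤⟨ +-mono-≤ (nCk-monoˡ-≤ k (m≤n+m a b)) (aCk*b≤[b+a]C[1+k] a b k) ⟩
  (b + a) C k + (b + a) C suc k      ≡⟨ nCk+nC[k+1]≡[n+1]C[k+1] (b + a) k ⟩
  suc (b + a) C suc k                ∎
  where open ≤-Reasoning

-- The previous inequality, with exactly `k` elements in the first part, bounds `n C suc k` below by
-- `n ∸ k`.
2≤nCk : ∀ {k n} → 1 ≤ k → k < n → 2 ≤ n C k
2≤nCk {suc k} {n} _ 1+k<n = begin
  2                       ≤⟨ m+n≤o⇒m≤o∸n 2 1+k<n ⟩
  n ∸ k                   ≡⟨ *-identityˡ (n ∸ k) ⟨
  1 * (n ∸ k)             ≡⟨ cong (_* (n ∸ k)) (nCn≡1 k) ⟨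
  (k C k) * (n ∸ k)       ≤⟨ aCk*b≤[b+a]C[1+k] k (n ∸ k) k ⟩
  (n ∸ k + k) C suc k     ≡⟨ cong (_C suc k) (m∸n+n≡m (≤-trans (m≤n+m k 2) 1+k<n)) ⟩
  n C suc k               ∎
  where open ≤-Reasoning

-- Since `m r t` is at least `2 * r`, the ground set of the binomial contains two disjoint parts of
-- size `r`: choose `t` elements in one and one element in the other.
nS-large : ∀ r t → (r ∸ t + 1) * (r * (r C t)) + r ≤ nS r t
nS-large r t = +-monoˡ-≤ r (*-monoʳ-≤ (r ∸ t + 1) (begin
  r * (r C t)       ≡⟨ *-comm r (r C t) ⟩
  (r C t) * r       ≤⟨ aCk*b≤[b+a]C[1+k] r r t ⟩
  (r + r) C suc t   ≡⟨ cong₂ _C_ (cong (r +_) (sym (+-identityʳ r))) (+-comm 1 t) ⟩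
  (2 * r) C (t + 1) ≤⟨ nCk-monoˡ-≤ (t + 1) (m≤m⊔n (2 * r) _) ⟩
  m r t C (t + 1)   ∎))
  where open ≤-Reasoning

sumFin-zero : ∀ {k} {f : Fin k → ℕ} → (∀ i → f i ≡ 0) → sumFin f ≡ 0
sumFin-zero {zero}  f≡0 = refl
sumFin-zero {suc k} f≡0 = cong₂ _+_ (f≡0 zero) (sumFin-zero (f≡0 ∘ suc))

sumFin-single : ∀ {k} {f : Fin k → ℕ} l → (∀ i → i ≢ l → f i ≡ 0) → sumFin f ≡ f l
sumFin-single {f = f} zero    f≡0 =
  trans (cong (f zero +_) (sumFin-zero (λ i → f≡0 (suc i) λ ()))) (+-identityʳ (f zero))
sumFin-single {f = f} (suc l) f≡0 =
  cong₂ _+_ (f≡0 zero λ ()) (sumFin-single l (λ i i≢l → f≡0 (suc i) (i≢l ∘ Fin.suc-injective)))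

-- There are `k` terms, each at most c/(k + 1). The denominator k + 1 instead of k makes the
-- inequality strict.
sumFin-< : ∀ {k} (f : Fin k → ℕ) {c} → 1 ≤ c → (∀ i → suc k * f i ≤ c) → sumFin f < c
sumFin-< {k} f {c} 1≤c f≤ = *-cancelˡ-< (suc k) (sumFin f) c (begin-strict
  suc k * sumFin f                ≡⟨ cong (suc k *_) (sumFin≡∑ f) ⟩
  suc k * ∑ (allFin k) f          ≡⟨ ∑-* (suc k) (allFin k) f ⟨
  ∑ (allFin k) (λ i → suc k * f i) ≤⟨ ∑-mono (allFin k) (λ {i} _ → f≤ i) ⟩
  ∑ (allFin k) (λ _ → c)          ≡⟨ ∑-const (allFin k) c ⟩
  length (allFin k) * c           ≡⟨ cong (_* c) (length-tabulate {n = k} id) ⟩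
  k * c                           <⟨ m<n+m (k * c) 1≤c ⟩
  suc k * c                       ∎)
  where open ≤-Reasoning

-- The exceptional term takes at most half of `c`. The other terms, doubled, satisfy the hypothesis
-- of `sumFin-<` and so take strictly less than the other half.
sumFin-<-except : ∀ {k} (f : Fin k → ℕ) {c} l → 1 ≤ c → 2 * f l ≤ c →
                  (∀ i → i ≢ l → suc k * (2 * f i) ≤ c) → sumFin f < c
sumFin-<-except {k} f {c} l 1≤c f-l≤ f≤ = *-cancelˡ-< 2 (sumFin f) c (begin-strict
  2 * sumFin f
    ≡⟨ cong (2 *_) (sumFin≡∑ f) ⟩
  2 * ∑ (allFin k) f
    ≡⟨ ∑-* 2 (allFin k) f ⟨
  ∑ (allFin k) (λ i → 2 * f i)
    ≤⟨ ∑-mono (allFin k) (λ {i} _ → split i) ⟩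
  ∑ (allFin k) (λ i → at-l i + off-l i)
    ≡⟨ ∑-+ (allFin k) at-l off-l ⟩
  ∑ (allFin k) at-l + ∑ (allFin k) off-l
    ≡⟨ cong₂ _+_ (sumFin≡∑ at-l) (sumFin≡∑ off-l) ⟨
  sumFin at-l + sumFin off-l
    <⟨ +-mono-≤-< (≤-trans (≤-reflexive (sumFin-single l at-l≡0)) (𝟙*-≤ (l Fin.≟ l) (λ _ → f-l≤)))
                  (sumFin-< off-l 1≤c off-l≤) ⟩
  c + c
    ≡⟨ cong (c +_) (+-identityʳ c) ⟨
  2 * c ∎)
  where
  open ≤-Reasoning
  at-l off-l : Fin k → ℕ
  at-l i  = 𝟙 (i Fin.≟ l) * (2 * f i)
  off-l i = 𝟙 (¬? (i Fin.≟ l)) * (2 * f i)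

  split : ∀ i → 2 * f i ≤ at-l i + off-l i
  split i with i Fin.≟ l
  ... | yes _ = ≤-reflexive (sym (trans (+-identityʳ _) (+-identityʳ _)))
  ... | no _  = ≤-reflexive (sym (+-identityʳ _))

  at-l≡0 : ∀ i → i ≢ l → at-l i ≡ 0
  at-l≡0 i i≢l with i Fin.≟ l
  ... | yes i≡l = contradiction i≡l i≢l
  ... | no _    = refl

  off-l≤ : ∀ i → suc k * off-l i ≤ c
  off-l≤ i with i Fin.≟ l
  ... | yes _   = ≤-trans (≤-reflexive (*-zeroʳ (suc k))) z≤n
  ... | no i≢l  = ≤-trans (≤-reflexive (cong (suc k *_) (+-identityʳ _))) (f≤ i i≢l)

-- Subsets

ins del : Subset n → Fin n → Subset n
ins X y = X [ y ]≔ inside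
del X y = X [ y ]≔ outside

∈-ins : ∀ (X : Subset n) y → y ∈ ins X y
∈-ins X y = Vec.[]≔-updates X y

⊆-ins : ∀ (X : Subset n) y → X ⊆ ins X y
⊆-ins X y {x} x∈X with x Fin.≟ y
... | yes refl = ∈-ins X y
... | no x≢y   = Vec.[]≔-minimal X x y x≢y x∈X

-- Writing the original entry back at `y` restores `X`, and this second update does not touch `x`.
∈-[]≔⁻ : ∀ (X : Subset n) {x} y s → x ≢ y → x ∈ X [ y ]≔ s → x ∈ X
∈-[]≔⁻ X {x} y s x≢y x∈ = subst (x ∈_) (trans (Vec.[]≔-idempotent X y) (Vec.[]≔-lookup X y))
                                 (Vec.[]≔-minimal (X [ y ]≔ s) x y x≢y x∈)

∈-ins⁻ : ∀ (X : Subset n) {x} y → x ∈ ins X y → x ≢ y → x ∈ X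
∈-ins⁻ X y x∈ x≢y = ∈-[]≔⁻ X y inside x≢y x∈

ins-⊆ : ∀ {X Y : Subset n} {y} → X ⊆ Y → y ∈ Y → ins X y ⊆ Y
ins-⊆ {X = X} {y = y} X⊆Y y∈Y {x} x∈ with x Fin.≟ y
... | yes refl = y∈Y
... | no x≢y   = X⊆Y (∈-ins⁻ X y x∈ x≢y)

∈-del : ∀ (X : Subset n) {x} y → x ∈ X → x ≢ y → x ∈ del X y
∈-del X {x} y x∈X x≢y = Vec.[]≔-minimal X x y x≢y x∈X

∉-del : ∀ (X : Subset n) y → y ∉ del X y
∉-del X y y∈ with Vec.[]=⇒lookup y∈ | Vec.[]=⇒lookup (Vec.[]≔-updates {x = outside} X y)
... | e | e′ with trans (sym e) e′
... | ()

del-⊆ : ∀ (X : Subset n) y → del X y ⊆ X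
del-⊆ X y {x} x∈ with x Fin.≟ y
... | yes refl = contradiction x∈ (∉-del X y)
... | no x≢y   = ∈-[]≔⁻ X y outside x≢y x∈

∣ins∣ : ∀ (X : Subset n) y → y ∉ X → ∣ ins X y ∣ ≡ suc ∣ X ∣
∣ins∣ (true  ∷ X) zero    y∉X = contradiction here y∉X
∣ins∣ (false ∷ X) zero    y∉X = refl
∣ins∣ (true  ∷ X) (suc y) y∉X = cong suc (∣ins∣ X y (y∉X ∘ there))
∣ins∣ (false ∷ X) (suc y) y∉X = ∣ins∣ X y (y∉X ∘ there)

∣del∣ : ∀ (X : Subset n) y → y ∈ X → suc ∣ del X y ∣ ≡ ∣ X ∣
∣del∣ (true  ∷ X) zero    y∈X = refl
∣del∣ (true  ∷ X) (suc y) y∈X = cong suc (∣del∣ X y (drop-there y∈X))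
∣del∣ (false ∷ X) (suc y) y∈X = ∣del∣ X y (drop-there y∈X)

exchange : Subset n → Fin n → Fin n → Subset n
exchange X y b = ins (del X y) b

∣exchange∣ : ∀ (X : Subset n) {y b} → y ∈ X → b ∉ X → ∣ exchange X y b ∣ ≡ ∣ X ∣
∣exchange∣ X {y} {b} y∈X b∉X =
  trans (∣ins∣ (del X y) b (b∉X ∘ del-⊆ X y)) (∣del∣ X y y∈X)

exchange-⊆ : ∀ (X : Subset n) y b → exchange X y b ⊆ ins X b
exchange-⊆ X y b = ins-⊆ (⊆-ins X b ∘ del-⊆ X y) (∈-ins X b)

∉-exchange : ∀ (X : Subset n) {y b} → y ≢ b → y ∉ exchange X y b
∉-exchange X {y} {b} y≢b y∈ = ∉-del X y (∈-ins⁻ (del X y) b y∈ y≢b)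

-- A point of `X` other than `y` survives the exchange and differs from `b`, so it comes from `Y`.
-- Used in both directions, this makes the exchange injective.
exchange-cancel-⊆ : ∀ (X Y : Subset n) {y b} → b ∉ X → y ∈ Y →
                    exchange X y b ≡ exchange Y y b → X ⊆ Y
exchange-cancel-⊆ X Y {y} {b} b∉X y∈Y e {x} x∈X with x Fin.≟ y
... | yes refl = y∈Y
... | no x≢y   = del-⊆ Y y (∈-ins⁻ (del Y y) b
                   (subst (x ∈_) e (⊆-ins (del X y) b (∈-del X y x∈X x≢y)))
                   (λ where refl → b∉X x∈X))

∈-∖? : ∀ (X Y : Subset n) → Decidable (λ b → b ∈ X × b ∉ Y)
∈-∖? X Y b = (b ∈? X) ×-dec ¬? (b ∈? Y)

∣X∣≤∣X∖Y∣+∣Y∣ : ∀ (X Y : Subset n) → ∣ X ∣ ≤ ∑ (allFin n) (𝟙 ∘ ∈-∖? X Y) + ∣ Y ∣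
∣X∣≤∣X∖Y∣+∣Y∣ {n} X Y = subst (λ s → ∣ X ∣ ≤ s + ∣ Y ∣) (sumFin≡∑ (𝟙 ∘ ∈-∖? X Y)) (lemma X Y)
  where
  -- The induction uses `sumFin`, whose unfolding follows the entries of the two vectors.
  lemma : ∀ {n} (X Y : Subset n) → ∣ X ∣ ≤ sumFin (𝟙 ∘ ∈-∖? X Y) + ∣ Y ∣
  lemma []          []          = z≤n
  lemma (true  ∷ X) (true  ∷ Y) = ≤-trans (s≤s (lemma X Y)) (≤-reflexive (sym (+-suc _ ∣ Y ∣)))
  lemma (true  ∷ X) (false ∷ Y) = s≤s (lemma X Y)
  lemma (false ∷ X) (true  ∷ Y) = ≤-trans (lemma X Y) (+-monoʳ-≤ _ (n≤1+n ∣ Y ∣))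
  lemma (false ∷ X) (false ∷ Y) = lemma X Y

∣X∖Y∣+∣Y∣≤∣X∣ : ∀ {X Y : Subset n} → Y ⊆ X → ∑ (allFin n) (𝟙 ∘ ∈-∖? X Y) + ∣ Y ∣ ≤ ∣ X ∣
∣X∖Y∣+∣Y∣≤∣X∣ {n} {X} {Y} Y⊆X =
  subst (λ s → s + ∣ Y ∣ ≤ ∣ X ∣) (sumFin≡∑ (𝟙 ∘ ∈-∖? X Y)) (lemma X Y Y⊆X)
  where
  lemma : ∀ {n} (X Y : Subset n) → Y ⊆ X → sumFin (𝟙 ∘ ∈-∖? X Y) + ∣ Y ∣ ≤ ∣ X ∣
  lemma []          []          Y⊆X = z≤n
  lemma (true  ∷ X) (true  ∷ Y) Y⊆X =
    ≤-trans (≤-reflexive (+-suc _ ∣ Y ∣)) (s≤s (lemma X Y (drop-∷-⊆ Y⊆X)))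
  lemma (true  ∷ X) (false ∷ Y) Y⊆X = s≤s (lemma X Y (drop-∷-⊆ Y⊆X))
  lemma (false ∷ X) (true  ∷ Y) Y⊆X with Y⊆X here
  ... | ()
  lemma (false ∷ X) (false ∷ Y) Y⊆X = lemma X Y (drop-∷-⊆ Y⊆X)

choose : Subset n → ℕ → List (Subset n)
choose []          zero    = [ [] ]
choose []          (suc t) = []
choose (true  ∷ X) zero    = map (false ∷_) (choose X zero)
choose (true  ∷ X) (suc t) = map (true ∷_) (choose X t) ++ map (false ∷_) (choose X (suc t))
choose (false ∷ X) t       = map (false ∷_) (choose X t)

length-choose : ∀ (X : Subset n) t → length (choose X t) ≡ ∣ X ∣ C t
length-choose []          zero    = refl
length-choose []          (suc t) = refl
length-choose (true  ∷ X) zero    = trans (length-map (false ∷_) (choose X zero)) (length-choose X zero)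
length-choose (true  ∷ X) (suc t) = begin-equality
  length (map (true ∷_) (choose X t) ++ map (false ∷_) (choose X (suc t)))
    ≡⟨ length-++ (map (true ∷_) (choose X t)) ⟩
  length (map (true ∷_) (choose X t)) + length (map (false ∷_) (choose X (suc t)))
    ≡⟨ cong₂ _+_ (length-map (true ∷_) (choose X t)) (length-map (false ∷_) (choose X (suc t))) ⟩
  length (choose X t) + length (choose X (suc t))
    ≡⟨ cong₂ _+_ (length-choose X t) (length-choose X (suc t)) ⟩
  ∣ X ∣ C t + ∣ X ∣ C suc t
    ≡⟨ nCk+nC[k+1]≡[n+1]C[k+1] ∣ X ∣ t ⟩
  suc ∣ X ∣ C suc t ∎
  where open ≤-Reasoning
length-choose (false ∷ X) t       = trans (length-map (false ∷_) (choose X t)) (length-choose X t)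

∈-choose⁻ : ∀ (X : Subset n) t {T} → T ∈ˡ choose X t → ∣ T ∣ ≡ t
∈-choose⁻ []          zero    (here refl) = refl
∈-choose⁻ (true  ∷ X) zero    T∈ with _ , T′∈ , refl ← ∈-map⁻ (false ∷_) T∈ = ∈-choose⁻ X zero T′∈
∈-choose⁻ (true  ∷ X) (suc t) T∈ with ∈-++⁻ (map (true ∷_) (choose X t)) T∈
... | inj₁ T∈₁ with _ , T′∈ , refl ← ∈-map⁻ (true ∷_) T∈₁ = cong suc (∈-choose⁻ X t T′∈)
... | inj₂ T∈₂ with _ , T′∈ , refl ← ∈-map⁻ (false ∷_) T∈₂ = ∈-choose⁻ X (suc t) T′∈
∈-choose⁻ (false ∷ X) t       T∈ with _ , T′∈ , refl ← ∈-map⁻ (false ∷_) T∈ = ∈-choose⁻ X t T′∈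

-- The first `t` common points of `X` and `Z` form `T`. Hence the stars of the `t`-subsets of `X`
-- cover all sets that `t`-intersect `X`.
∃-choose : ∀ (X Z : Subset n) t → t ≤ ∣ Z ∩ X ∣ → ∃ λ T → T ∈ˡ choose X t × T ⊆ Z
∃-choose []          []          zero    _ = [] , here refl , id
∃-choose (true  ∷ X) (z     ∷ Z) zero    _ =
  let T , T∈ , T⊆Z = ∃-choose X Z zero z≤n in false ∷ T , ∈-map⁺ (false ∷_) T∈ , out⊆ T⊆Z
∃-choose (true  ∷ X) (true  ∷ Z) (suc t) (s≤s t≤) =
  let T , T∈ , T⊆Z = ∃-choose X Z t t≤ in
  true ∷ T , ∈-++⁺ˡ (∈-map⁺ (true ∷_) T∈) , in⊆in T⊆Z
∃-choose (true  ∷ X) (false ∷ Z) (suc t) t≤ =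
  let T , T∈ , T⊆Z = ∃-choose X Z (suc t) t≤ in
  false ∷ T , ∈-++⁺ʳ (map (true ∷_) (choose X t)) (∈-map⁺ (false ∷_) T∈) , out⊆ T⊆Z
∃-choose (false ∷ X) (true  ∷ Z) t       t≤ =
  let T , T∈ , T⊆Z = ∃-choose X Z t t≤ in false ∷ T , ∈-map⁺ (false ∷_) T∈ , out⊆ T⊆Z
∃-choose (false ∷ X) (false ∷ Z) t       t≤ =
  let T , T∈ , T⊆Z = ∃-choose X Z t t≤ in false ∷ T , ∈-map⁺ (false ∷_) T∈ , out⊆ T⊆Z

p⊆q∧∣q∣≤∣p∣⇒q⊆p : ∀ {X Y : Subset n} → X ⊆ Y → ∣ Y ∣ ≤ ∣ X ∣ → Y ⊆ X
p⊆q∧∣q∣≤∣p∣⇒q⊆p {X = X} {Y} X⊆Y ∣Y∣≤∣X∣ {x} x∈Y with x ∈? X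
... | yes x∈X = x∈X
... | no  x∉X = contradiction (p⊂q⇒∣p∣<∣q∣ (X⊆Y , x , x∈Y , x∉X)) (≤⇒≯ ∣Y∣≤∣X∣)

-- Counting families of sets

allSubsets-unique : ∀ n → Unique (allSubsets n)
allSubsets-unique zero    = [] ∷ []
allSubsets-unique (suc n) =
  Unique.++⁺ (Unique.map⁺ (λ where refl → refl) (allSubsets-unique n))
             (Unique.map⁺ (λ where refl → refl) (allSubsets-unique n))
             λ where (X∈₁ , X∈₂) → disjoint (∈-map⁻ (true ∷_) X∈₁) (∈-map⁻ (false ∷_) X∈₂)
  where
  disjoint : ∀ {X} → (∃ λ Y → Y ∈ˡ allSubsets n × X ≡ true ∷ Y) →
             ¬ (∃ λ Z → Z ∈ˡ allSubsets n × X ≡ false ∷ Z)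
  disjoint (_ , _ , refl) (_ , _ , ())

∈-allSubsets : ∀ (X : Subset n) → X ∈ˡ allSubsets n
∈-allSubsets []          = here refl
∈-allSubsets (true  ∷ X) = ∈-++⁺ˡ (∈-map⁺ (true ∷_) (∈-allSubsets X))
∈-allSubsets (false ∷ X) = ∈-++⁺ʳ (map (true ∷_) (allSubsets _)) (∈-map⁺ (false ∷_) (∈-allSubsets X))

-- Counting by a decidable predicate lets stars and covers be counted without Boolean encodings;
-- `card≡#` gives the link to `card`.
# : {P : Subset n → Set p} → Decidable P → ℕ
# {n} P? = ∑ (allSubsets n) (𝟙 ∘ P?)

#-mono : {P : Subset n → Set p} {Q : Subset n → Set q} (P? : Decidable P) (Q? : Decidable Q) →
         (∀ X → P X → Q X) → # P? ≤ # Q?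
#-mono {n = n} P? Q? P⇒Q = ∑-mono (allSubsets n) (λ {X} _ → 𝟙-mono (P? X) (Q? X) (P⇒Q X))

1≤# : {P : Subset n → Set p} (P? : Decidable P) {X : Subset n} → P X → 1 ≤ # P?
1≤# P? {X} PX = ≤-trans (1≤𝟙 (P? X) PX) (∈⇒≤∑ (𝟙 ∘ P?) (∈-allSubsets X))

#≡0 : {P : Subset n → Set p} (P? : Decidable P) → (∀ X → ¬ P X) → # P? ≡ 0
#≡0 {n} P? ¬P = ∑𝟙≡0 P? (All.universal ¬P (allSubsets n))

#-disjoint : {P Q R : Subset n → Set} (P? : Decidable P) (Q? : Decidable Q) (R? : Decidable R) →
             (∀ X → P X → R X) → (∀ X → Q X → R X) → (∀ X → P X → ¬ Q X) → # P? + # Q? ≤ # R?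
#-disjoint {n} P? Q? R? P⇒R Q⇒R P⇒¬Q =
  ≤-trans (≤-reflexive (sym (∑-+ (allSubsets n) (𝟙 ∘ P?) (𝟙 ∘ Q?))))
          (∑-mono (allSubsets n) (λ {X} _ → pointwise X))
  where
  pointwise : ∀ X → 𝟙 (P? X) + 𝟙 (Q? X) ≤ 𝟙 (R? X)
  pointwise X with P? X | Q? X
  ... | yes PX | yes QX = contradiction QX (P⇒¬Q X PX)
  ... | yes PX | no _   = 1≤𝟙 (R? X) (P⇒R X PX)
  ... | no _   | yes QX = 1≤𝟙 (R? X) (Q⇒R X QX)
  ... | no _   | no _   = z≤n

#-union : {P : Subset n → Set} {G : A → Subset n → Set} (P? : Decidable P)
          (G? : ∀ x → Decidable (G x)) (xs : List A) →
          (∀ X → P X → ∃ λ x → x ∈ˡ xs × G x X) → # P? ≤ ∑ xs (λ x → # (G? x))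
#-union {n} P? G? xs cover = begin
  # P?                                              ≤⟨ ∑-mono (allSubsets n) (λ {X} _ → pointwise X) ⟩
  ∑ (allSubsets n) (λ X → ∑ xs (λ x → 𝟙 (G? x X)))  ≡⟨ ∑-swap (allSubsets n) xs _ ⟩
  ∑ xs (λ x → # (G? x))                             ∎
  where
  open ≤-Reasoning
  pointwise : ∀ X → 𝟙 (P? X) ≤ ∑ xs (λ x → 𝟙 (G? x X))
  pointwise X with P? X
  ... | no _ = z≤n
  ... | yes PX = let x , x∈ , Gx = cover X PX in
                 ≤-trans (1≤𝟙 (G? x X) Gx) (∈⇒≤∑ (λ x → 𝟙 (G? x X)) x∈)

_∈F?_ : ∀ X (F : Family n) → Dec (F X ≡ true)
X ∈F? F = F X Bool.≟ true

card≡# : ∀ (F : Family n) → card F ≡ # (_∈F? F)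
card≡# {n} F = lemma (allSubsets n)
  where
  lemma : ∀ Xs → length (filter (λ X → T? (F X)) Xs) ≡ ∑ Xs (λ X → 𝟙 (X ∈F? F))
  lemma [] = refl
  lemma (X ∷ Xs) with F X
  ... | true  = cong suc (lemma Xs)
  ... | false = lemma Xs

-- Stars in a hereditary family with large bases

levelUnion⁺ : ∀ (H : Family n) S X → H X ≡ true → S ∣ X ∣ ≡ true → levelUnion H S X ≡ true
levelUnion⁺ H S X HX SX rewrite HX = SX

levelUnion⁻ : ∀ (H : Family n) S X → levelUnion H S X ≡ true → H X ≡ true × S ∣ X ∣ ≡ true
levelUnion⁻ H S X FX = ∧-conicalˡ (H X) _ FX , ∧-conicalʳ (H X) _ FX

isBase? : ∀ (H : Family n) → Decidable (IsBase H)
isBase? H B with B ∈F? H | anySubset? (λ D → (D ∈F? H) ×-dec (B ⊂? D))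
... | no  B∉H | _                    = no (B∉H ∘ proj₁)
... | yes B∈H | yes (D , D∈H , B⊂D) = no (λ base → proj₂ base D D∈H B⊂D)
... | yes B∈H | no  maximal         = yes (B∈H , λ D D∈H B⊂D → maximal (D , D∈H , B⊂D))

-- Replace `X` by a proper superset in `H` as long as there is one; `n ∸ ∣ X ∣` drops each time and
-- is bounded by the fuel.
∃-base : ∀ (H : Family n) {X} → H X ≡ true → ∃ λ B → IsBase H B × X ⊆ B
∃-base {n} H {X} X∈H = go (n ∸ ∣ X ∣) X X∈H ≤-refl
  where
  go : ∀ fuel X → H X ≡ true → n ∸ ∣ X ∣ ≤ fuel → ∃ λ B → IsBase H B × X ⊆ B
  go fuel X X∈H ≤fuel with anySubset? (λ D → (D ∈F? H) ×-dec (X ⊂? D))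
  ... | no maximal = X , (X∈H , λ D D∈H X⊂D → maximal (D , D∈H , X⊂D)) , id
  go zero X X∈H ≤0 | yes (D , D∈H , X⊂D) =
    contradiction (≤-trans (p⊂q⇒∣p∣<∣q∣ X⊂D) (∣p∣≤n D)) (≤⇒≯ (m∸n≡0⇒m≤n (n≤0⇒n≡0 ≤0)))
  go (suc fuel) X X∈H ≤fuel | yes (D , D∈H , X⊂D) =
    let smaller = ∸-monoʳ-< (p⊂q⇒∣p∣<∣q∣ X⊂D) (∣p∣≤n D)
        B , base , D⊆B = go fuel D D∈H (≤-pred (≤-trans smaller ≤fuel))
    in B , base , λ x∈X → D⊆B (proj₁ X⊂D x∈X)

-- Descent on the size, started from a base above `X`. The size reached is μ(H), from which the
-- number `N` is obtained.
∃-smallest-base : ∀ (H : Family n) {X} → H X ≡ true →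
                  ∃ λ B → IsBase H B × (∀ D → IsBase H D → ∣ B ∣ ≤ ∣ D ∣)
∃-smallest-base {n} H X∈H = let B , base , _ = ∃-base H X∈H in go ∣ B ∣ B base ≤-refl
  where
  go : ∀ fuel B → IsBase H B → ∣ B ∣ ≤ fuel →
       ∃ λ B → IsBase H B × (∀ D → IsBase H D → ∣ B ∣ ≤ ∣ D ∣)
  go fuel B base ≤fuel with anySubset? (λ D → isBase? H D ×-dec (∣ D ∣ <? ∣ B ∣))
  ... | no smallest = B , base , λ D base′ → ≮⇒≥ (λ D<B → smallest (D , base′ , D<B))
  go zero B base ≤0 | yes (D , base′ , D<B) = contradiction (≤-trans D<B ≤0) λ ()
  go (suc fuel) B base ≤fuel | yes (D , base′ , D<B) = go fuel D base′ (≤-pred (≤-trans D<B ≤fuel))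

-- With `N + r` as a lower bound for the size of every base, the counting below is free of truncated
-- subtraction from base sizes.
module Stars {n} (H : Family n) (hereditary : Hereditary H) (r N : ℕ)
             (large : ∀ B → IsBase H B → N + r ≤ ∣ B ∣)
             (S : ℕ → Bool) (S≤r : ∀ s → S s ≡ true → s ≤ r) where

  private
    F : Family n
    F = levelUnion H S

    ∣F∣≤r : ∀ X → F X ≡ true → ∣ X ∣ ≤ r
    ∣F∣≤r X FX = S≤r ∣ X ∣ (proj₂ (levelUnion⁻ H S X FX))

  star? : ∀ T → Decidable (λ X → F X ≡ true × T ⊆ X)
  star? T X = (X ∈F? F) ×-dec (T ⊆? X)

  degree : Subset n → ℕ
  degree T = # (star? T)

  -- A base above `X` has at least `N` points outside `X`, and by heredity each of them extends `X`
  -- within `H`. The extension may leave `F`, because its size is larger.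
  many-extensions : ∀ X → F X ≡ true →
    N ≤ ∑ (allFin n) (λ b → 𝟙 (¬? (b ∈? X) ×-dec (ins X b ∈F? H)))
  many-extensions X FX =
    let B , base , X⊆B = ∃-base H (proj₁ (levelUnion⁻ H S X FX)) in
    +-cancelʳ-≤ r N _ (begin
      N + r
        ≤⟨ large B base ⟩
      ∣ B ∣
        ≤⟨ ∣X∣≤∣X∖Y∣+∣Y∣ B X ⟩
      ∑ (allFin n) (𝟙 ∘ ∈-∖? B X) + ∣ X ∣
        ≤⟨ +-mono-≤ (∑-mono (allFin n) (λ {b} _ →
             𝟙-mono (∈-∖? B X b) (¬? (b ∈? X) ×-dec (ins X b ∈F? H)) (λ (b∈B , b∉X) →
               b∉X , hereditary B (ins X b) (ins-⊆ X⊆B b∈B) (proj₁ base))))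
             (∣F∣≤r X FX) ⟩
      ∑ (allFin n) (λ b → 𝟙 (¬? (b ∈? X) ×-dec (ins X b ∈F? H))) + r ∎)
    where open ≤-Reasoning

  -- Double counting of the pairs (Z , b) with Z in the star of T ∪ {y} and Z ∪ {b} ∈ H, b ∉ Z:
  -- for fixed b the exchange Z ↦ (Z ∖ {y}) ∪ {b} is injective.
  degree-exchange : ∀ T y → y ∉ T →
    N * degree (ins T y) ≤ (r ∸ ∣ T ∣) * # (λ W → star? T W ×-dec ¬? (y ∈? W))
  degree-exchange T y y∉T = begin
    N * degree (ins T y)
      ≡⟨ ∑-* N (allSubsets n) (𝟙 ∘ star? (ins T y)) ⟨
    ∑ (allSubsets n) (λ Z → N * 𝟙 (star? (ins T y) Z))
      ≤⟨ ∑-mono (allSubsets n) (λ {Z} _ →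
           ≤-trans (≤-reflexive (*-comm N _)) (𝟙*-≤ (star? (ins T y) Z) (extend Z))) ⟩
    ∑ (allSubsets n) (λ Z → ∑ (allFin n) (λ b → 𝟙 (before? b Z)))
      ≡⟨ ∑-swap (allSubsets n) (allFin n) (λ Z b → 𝟙 (before? b Z)) ⟩
    ∑ (allFin n) (λ b → # (before? b))
      ≤⟨ ∑-mono (allFin n) (λ {b} _ → ∑-injective (before? b) (after? b)
           (Vec.≡-dec Bool._≟_) (allSubsets-unique n) ∈-allSubsets
           (λ Z → exchange Z y b) (λ {Z} → moves b Z)
           (λ {Z} {Z′} → injective b Z Z′)) ⟩
    ∑ (allFin n) (λ b → # (after? b))
      ≡⟨ ∑-swap (allFin n) (allSubsets n) (λ b W → 𝟙 (after? b W)) ⟩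
    ∑ (allSubsets n) (λ W → ∑ (allFin n) (λ b → 𝟙 (after? b W)))
      ≤⟨ ∑-mono (allSubsets n) (λ {W} _ → few W) ⟩
    ∑ (allSubsets n) (λ W → (r ∸ ∣ T ∣) * 𝟙 (star? T W ×-dec ¬? (y ∈? W)))
      ≡⟨ ∑-* (r ∸ ∣ T ∣) (allSubsets n) _ ⟩
    (r ∸ ∣ T ∣) * # (λ W → star? T W ×-dec ¬? (y ∈? W)) ∎
    where
    open ≤-Reasoning

    Before After : Fin n → Subset n → Set
    Before b Z = (F Z ≡ true × ins T y ⊆ Z) × b ∉ Z × H (ins Z b) ≡ true
    After b W = ((F W ≡ true × T ⊆ W) × y ∉ W) × b ∈ W × b ∉ T

    before? : ∀ b → Decidable (Before b)
    before? b Z = star? (ins T y) Z ×-dec (¬? (b ∈? Z) ×-dec (ins Z b ∈F? H))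

    after? : ∀ b → Decidable (After b)
    after? b W = (star? T W ×-dec ¬? (y ∈? W)) ×-dec ∈-∖? W T b

    extend : ∀ Z → F Z ≡ true × ins T y ⊆ Z → N ≤ ∑ (allFin n) (λ b → 𝟙 (before? b Z))
    extend Z Z∈ = ≤-trans (many-extensions Z (proj₁ Z∈))
      (∑-mono (allFin n) (λ {b} _ → 𝟙-mono (¬? (b ∈? Z) ×-dec (ins Z b ∈F? H)) (before? b Z) (Z∈ ,_)))

    -- The exchanged set lies in `H` as a subset of `ins Z b`, and it has the size of `Z`, so it
    -- stays in `F`.
    moves : ∀ b Z → Before b Z → After b (exchange Z y b)
    moves b Z ((FZ , Ty⊆Z) , b∉Z , HZb) =
      ((levelUnion⁺ H S (exchange Z y b) (hereditary _ _ (exchange-⊆ Z y b) HZb)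
         (subst (λ s → S s ≡ true) (sym (∣exchange∣ Z y∈Z b∉Z)) (proj₂ (levelUnion⁻ H S Z FZ)))
       , T⊆) , ∉-exchange Z (λ where refl → b∉Z y∈Z))
      , ∈-ins (del Z y) b , λ b∈T → b∉Z (Ty⊆Z (⊆-ins T y b∈T))
      where
      y∈Z : y ∈ Z
      y∈Z = Ty⊆Z (∈-ins T y)
      T⊆ : T ⊆ exchange Z y b
      T⊆ x∈T = ⊆-ins (del Z y) b
                 (∈-del Z y (Ty⊆Z (⊆-ins T y x∈T)) (λ where refl → y∉T x∈T))

    injective : ∀ b Z Z′ → Before b Z → Before b Z′ → exchange Z y b ≡ exchange Z′ y b → Z ≡ Z′
    injective b Z Z′ ((_ , Ty⊆Z) , b∉Z , _) ((_ , Ty⊆Z′) , b∉Z′ , _) e =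
      ⊆-antisym (exchange-cancel-⊆ Z Z′ b∉Z (Ty⊆Z′ (∈-ins T y)) e)
                (exchange-cancel-⊆ Z′ Z b∉Z′ (Ty⊆Z (∈-ins T y)) (sym e))

    -- Each `W` is reached only through points `b` of `W` outside `T`, of which there are at most
    -- `r ∸ ∣ T ∣`.
    few : ∀ W → ∑ (allFin n) (λ b → 𝟙 (after? b W)) ≤
                (r ∸ ∣ T ∣) * 𝟙 (star? T W ×-dec ¬? (y ∈? W))
    few W = by-cases (star? T W ×-dec ¬? (y ∈? W))
      where
      -- The decision is made an argument so that matching on it reduces both sides together.
      by-cases : (av? : Dec ((F W ≡ true × T ⊆ W) × y ∉ W)) →
                 ∑ (allFin n) (λ b → 𝟙 (av? ×-dec ∈-∖? W T b)) ≤ (r ∸ ∣ T ∣) * 𝟙 av?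
      by-cases (no ¬av) = ≤-trans (≤-reflexive (∑𝟙≡0 (λ b → no ¬av ×-dec ∈-∖? W T b)
                            (All.universal (λ _ → ¬av ∘ proj₁) (allFin n)))) z≤n
      by-cases (yes av@((FW , T⊆W) , _)) = begin
        ∑ (allFin n) (λ b → 𝟙 (yes av ×-dec ∈-∖? W T b))
          ≤⟨ ∑-mono (allFin n) (λ {b} _ →
               𝟙-mono (yes av ×-dec ∈-∖? W T b) (∈-∖? W T b) proj₂) ⟩
        ∑ (allFin n) (𝟙 ∘ ∈-∖? W T)
          ≤⟨ m+n≤o⇒m≤o∸n _ (≤-trans (∣X∖Y∣+∣Y∣≤∣X∣ T⊆W) (∣F∣≤r W FW)) ⟩
        r ∸ ∣ T ∣
          ≡⟨ *-identityʳ _ ⟨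
        (r ∸ ∣ T ∣) * 1 ∎

  N*degree-ins≤ : ∀ T y → y ∉ T → N * degree (ins T y) ≤ (r ∸ ∣ T ∣) * degree T
  N*degree-ins≤ T y y∉T = ≤-trans (degree-exchange T y y∉T)
    (*-monoʳ-≤ (r ∸ ∣ T ∣) (#-mono (λ W → star? T W ×-dec ¬? (y ∈? W)) (star? T) (λ _ → proj₁)))

  -- The exchange bound has only the sets avoiding `y` on its right side. Adding
  -- `r * degree (ins T y)` to both sides completes these sets to at most the whole star of `T`.
  [N+r]*degree-ins≤ : ∀ T y → y ∉ T → (N + r) * degree (ins T y) ≤ r * degree T
  [N+r]*degree-ins≤ T y y∉T = begin
    (N + r) * degree (ins T y)
      ≡⟨ *-distribʳ-+ (degree (ins T y)) N r ⟩
    N * degree (ins T y) + r * degree (ins T y)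
      ≤⟨ +-monoˡ-≤ _ (≤-trans (degree-exchange T y y∉T) (*-monoˡ-≤ _ (m∸n≤m r ∣ T ∣))) ⟩
    r * # avoid? + r * degree (ins T y)
      ≡⟨ *-distribˡ-+ r (# avoid?) (degree (ins T y)) ⟨
    r * (# avoid? + degree (ins T y))
      ≤⟨ *-monoʳ-≤ r (#-disjoint avoid? (star? (ins T y)) (star? T) (λ _ → proj₁)
           (λ X (FX , Ty⊆X) → FX , λ x∈T → Ty⊆X (⊆-ins T y x∈T))
           (λ X (_ , y∉X) (_ , Ty⊆X) → y∉X (Ty⊆X (∈-ins T y)))) ⟩
    r * degree T ∎
    where
    open ≤-Reasoning
    avoid? : Decidable (λ W → (F W ≡ true × T ⊆ W) × y ∉ W)
    avoid? W = star? T W ×-dec ¬? (y ∈? W)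

  -- Remove the points of `T` one at a time; each removal contributes one factor `N + r` on the left
  -- and one factor `r` on the right.
  [N+r]^∣T∣*degree≤ : ∀ u T → ∣ T ∣ ≡ u → (N + r) ^ u * degree T ≤ r ^ u * card F
  [N+r]^∣T∣*degree≤ zero T _ rewrite card≡# F =
    +-monoˡ-≤ 0 (#-mono (star? T) (_∈F? F) (λ _ → proj₁))
  [N+r]^∣T∣*degree≤ (suc u) T ∣T∣≡ with nonempty? T
  ... | no empty = contradiction (trans (sym ∣T∣≡) (trans (cong ∣_∣ (Empty-unique empty)) (∣⊥∣≡0 n))) λ ()
  ... | yes (y , y∈T) = begin
    (N + r) * (N + r) ^ u * degree T
      ≤⟨ *-monoʳ-≤ ((N + r) * (N + r) ^ u) (#-mono (star? T) (star? (ins T′ y))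
           (λ X (FX , T⊆X) → FX , λ x∈ → T⊆X (ins-⊆ (del-⊆ T y) y∈T x∈))) ⟩
    (N + r) * (N + r) ^ u * degree (ins T′ y)
      ≡⟨ swap₁ (N + r) ((N + r) ^ u) (degree (ins T′ y)) ⟩
    (N + r) ^ u * ((N + r) * degree (ins T′ y))
      ≤⟨ *-monoʳ-≤ ((N + r) ^ u) ([N+r]*degree-ins≤ T′ y (∉-del T y)) ⟩
    (N + r) ^ u * (r * degree T′)
      ≡⟨ swap₁ r ((N + r) ^ u) (degree T′) ⟨
    r * (N + r) ^ u * degree T′
      ≡⟨ *-assoc r _ _ ⟩
    r * ((N + r) ^ u * degree T′)
      ≤⟨ *-monoʳ-≤ r ([N+r]^∣T∣*degree≤ u T′ (suc-injective (trans (∣del∣ T y y∈T) ∣T∣≡))) ⟩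
    r * (r ^ u * card F)
      ≡⟨ *-assoc r _ _ ⟨
    r * r ^ u * card F ∎
    where
    open ≤-Reasoning
    T′ : Subset n
    T′ = del T y
    swap₁ : ∀ a b c → a * b * c ≡ b * (a * c)
    swap₁ = solve-∀

  -- A set of the family that contains T and meets Y in at least ∣T∣ points, where T ⊈ Y,
  -- contains T ∪ {y} for some y ∈ Y ∖ T.
  #-in-star≤ : ∀ {P : Subset n → Set} (P? : Decidable P) T Y → ¬ T ⊆ Y → ∣ Y ∣ ≤ r →
               (∀ X → P X → F X ≡ true × T ⊆ X) → (∀ X → P X → ∣ T ∣ ≤ ∣ X ∩ Y ∣) →
               N * # P? ≤ r * (r ∸ ∣ T ∣) * degree T
  #-in-star≤ {P} P? T Y T⊈Y ∣Y∣≤r P⇒star P⇒meets = begin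
    N * # P?
      ≤⟨ *-monoʳ-≤ N (#-union P? star-through? (allFin n) cover) ⟩
    N * ∑ (allFin n) (λ y → # (star-through? y))
      ≡⟨ ∑-* N (allFin n) (λ y → # (star-through? y)) ⟨
    ∑ (allFin n) (λ y → N * # (star-through? y))
      ≤⟨ ∑-mono (allFin n) (λ {y} _ → bound y) ⟩
    ∑ (allFin n) (λ y → (r ∸ ∣ T ∣) * degree T * 𝟙 (∈-∖? Y T y))
      ≡⟨ ∑-* ((r ∸ ∣ T ∣) * degree T) (allFin n) (𝟙 ∘ ∈-∖? Y T) ⟩
    (r ∸ ∣ T ∣) * degree T * ∑ (allFin n) (𝟙 ∘ ∈-∖? Y T)
      ≤⟨ *-monoʳ-≤ ((r ∸ ∣ T ∣) * degree T) few ⟩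
    (r ∸ ∣ T ∣) * degree T * r
      ≡⟨ rotate (r ∸ ∣ T ∣) (degree T) r ⟩
    r * (r ∸ ∣ T ∣) * degree T ∎
    where
    open ≤-Reasoning
    rotate : ∀ a b c → a * b * c ≡ c * a * b
    rotate = solve-∀

    Through : Fin n → Subset n → Set
    Through y X = (y ∈ Y × y ∉ T) × (F X ≡ true × ins T y ⊆ X)

    star-through? : ∀ y → Decidable (Through y)
    star-through? y X = ∈-∖? Y T y ×-dec star? (ins T y) X

    cover : ∀ X → P X → ∃ λ y → y ∈ˡ allFin n × Through y X
    cover X PX with Fin.any? (∈-∖? (X ∩ Y) T)
    ... | yes (y , y∈X∩Y , y∉T) =
      let y∈X , y∈Y = x∈p∩q⁻ X Y y∈X∩Y in
      y , ∈-allFin y , (y∈Y , y∉T) , proj₁ (P⇒star X PX) , ins-⊆ (proj₂ (P⇒star X PX)) y∈X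
    -- If `X ∩ Y` has no point outside `T`, then its size forces it to equal `T`, and so `T ⊆ Y`.
    ... | no ¬new = contradiction (λ {x} x∈T → proj₂ (x∈p∩q⁻ X Y (T⊆X∩Y x∈T))) T⊈Y
      where
      X∩Y⊆T : X ∩ Y ⊆ T
      X∩Y⊆T {x} x∈ = decidable-stable (x ∈? T) (λ x∉T → ¬new (x , x∈ , x∉T))
      T⊆X∩Y : T ⊆ X ∩ Y
      T⊆X∩Y = p⊆q∧∣q∣≤∣p∣⇒q⊆p X∩Y⊆T (P⇒meets X PX)

    bound : ∀ y → N * # (star-through? y) ≤ (r ∸ ∣ T ∣) * degree T * 𝟙 (∈-∖? Y T y)
    bound y = by-cases (∈-∖? Y T y)
      where
      by-cases : (d : Dec (y ∈ Y × y ∉ T)) →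
                 N * # (λ X → d ×-dec star? (ins T y) X) ≤ (r ∸ ∣ T ∣) * degree T * 𝟙 d
      by-cases (no ¬d) = ≤-trans (≤-reflexive (trans
        (cong (N *_) (#≡0 (λ X → no ¬d ×-dec star? (ins T y) X) (λ _ → ¬d ∘ proj₁)))
        (*-zeroʳ N))) z≤n
      by-cases (yes d) = begin
        N * # (λ X → yes d ×-dec star? (ins T y) X)
          ≤⟨ *-monoʳ-≤ N (#-mono (λ X → yes d ×-dec star? (ins T y) X) (star? (ins T y)) (λ _ → proj₂)) ⟩
        N * degree (ins T y)
          ≤⟨ N*degree-ins≤ T y (proj₂ d) ⟩
        (r ∸ ∣ T ∣) * degree T
          ≡⟨ *-identityʳ _ ⟨
        (r ∸ ∣ T ∣) * degree T * 1 ∎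

    -- As `T` need not lie in `Y`, the difference is first enlarged to `Y` minus the empty set.
    few : ∑ (allFin n) (𝟙 ∘ ∈-∖? Y T) ≤ r
    few = begin
      ∑ (allFin n) (𝟙 ∘ ∈-∖? Y T)
        ≤⟨ ∑-mono (allFin n) (λ {y} _ → 𝟙-mono (∈-∖? Y T y) (∈-∖? Y ⊥ y) (λ (y∈Y , _) → y∈Y , ∉⊥)) ⟩
      ∑ (allFin n) (𝟙 ∘ ∈-∖? Y ⊥)
        ≤⟨ m≤m+n _ ∣ ⊥ {n} ∣ ⟩
      ∑ (allFin n) (𝟙 ∘ ∈-∖? Y ⊥) + ∣ ⊥ {n} ∣
        ≤⟨ ∣X∖Y∣+∣Y∣≤∣X∣ {X = Y} (λ x∈⊥ → contradiction x∈⊥ ∉⊥) ⟩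
      ∣ Y ∣
        ≤⟨ ∣Y∣≤r ⟩
      r ∎

  -- Bounds on a subfamily of F by the sizes of stars

  module Bounds (t k : ℕ) (1≤t : 1 ≤ t) (t≤r : t ≤ r) (k*r^t≤N^t : k * r ^ t ≤ N ^ t)
                (N-large : (r ∸ t + 1) * (r * (r C t)) ≤ N) where

    private
      1≤r : 1 ≤ r
      1≤r = ≤-trans 1≤t t≤r

      instance
        r^t≢0 : NonZero (r ^ t)
        r^t≢0 = m^n≢0 r t {{>-nonZero 1≤r}}

    1≤N : 1 ≤ N
    1≤N = ≤-trans (*-mono-≤ (m≤n+m 1 (r ∸ t)) (*-mono-≤ 1≤r (1≤nCk t≤r))) N-large

    -- The ratio of `card F` to `degree T` is at least that of `(N + r) ^ t` to `r ^ t`, so every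
    -- `c` below the latter is admissible.
    cancel-r^t : ∀ c T → ∣ T ∣ ≡ t → c * r ^ t ≤ (N + r) ^ t → c * degree T ≤ card F
    cancel-r^t c T ∣T∣≡t c≤ = *-cancelˡ-≤ (r ^ t) (begin
      r ^ t * (c * degree T)  ≡⟨ rearrange (r ^ t) c (degree T) ⟩
      c * r ^ t * degree T    ≤⟨ *-monoˡ-≤ (degree T) c≤ ⟩
      (N + r) ^ t * degree T  ≤⟨ [N+r]^∣T∣*degree≤ t T ∣T∣≡t ⟩
      r ^ t * card F          ∎)
      where
      open ≤-Reasoning
      rearrange : ∀ a b c → a * (b * c) ≡ b * a * c
      rearrange = solve-∀

    -- The hypothesis on roots gives the factor `k` for `N` alone; the further `r` in `N + r` raises
    -- it to `suc k` by superadditivity.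
    [1+k]*degree≤ : ∀ T → ∣ T ∣ ≡ t → suc k * degree T ≤ card F
    [1+k]*degree≤ T ∣T∣≡t = cancel-r^t (suc k) T ∣T∣≡t (begin
      r ^ t + k * r ^ t  ≤⟨ +-monoʳ-≤ (r ^ t) k*r^t≤N^t ⟩
      r ^ t + N ^ t      ≡⟨ +-comm (r ^ t) (N ^ t) ⟩
      N ^ t + r ^ t      ≤⟨ ^-superadditive N r 1≤t ⟩
      (N + r) ^ t        ∎)
      where open ≤-Reasoning

    -- As `t < r`, the factor `r ∸ t + 1` is at least 2, so `N` is at least `2 * (r C t) * r`.
    2*nCt*degree≤ : t < r → ∀ T → ∣ T ∣ ≡ t → 2 * (r C t) * degree T ≤ card F
    2*nCt*degree≤ t<r T ∣T∣≡t =
      cancel-r^t (2 * (r C t)) T ∣T∣≡t (c*a^t≤b^t (2 * (r C t)) 1≤t 2Cr≤ (m≤n+m r N))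
      where
      open ≤-Reasoning
      2Cr≤ : 2 * (r C t) * r ≤ N + r
      2Cr≤ = begin
        2 * (r C t) * r                    ≡⟨ *-assoc 2 (r C t) r ⟩
        2 * ((r C t) * r)                  ≡⟨ cong (2 *_) (*-comm (r C t) r) ⟩
        2 * (r * (r C t))                  ≤⟨ *-monoˡ-≤ (r * (r C t)) (+-monoˡ-≤ 1 (m<n⇒0<n∸m t<r)) ⟩
        (r ∸ t + 1) * (r * (r C t))        ≤⟨ N-large ⟩
        N                                  ≤⟨ m≤m+n N r ⟩
        N + r                              ∎

    module _ (A : Family n) (A⊆F : A ⊆F F) where

      private
        in-star? : ∀ T → Decidable (λ X → A X ≡ true × T ⊆ X)
        in-star? T X = (X ∈F? A) ×-dec (T ⊆? X)

        in-star⊆ : ∀ T X → A X ≡ true × T ⊆ X → F X ≡ true × T ⊆ X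
        in-star⊆ T X (AX , T⊆X) = A⊆F X AX , T⊆X

      card≤∑choose : ∀ X → (∀ Z → A Z ≡ true → t ≤ ∣ Z ∩ X ∣) →
                     card A ≤ ∑ (choose X t) (λ T → # (in-star? T))
      card≤∑choose X meets rewrite card≡# A =
        #-union (_∈F? A) in-star? (choose X t) (λ Z AZ →
          let T , T∈ , T⊆Z = ∃-choose X Z t (meets Z AZ) in T , T∈ , AZ , T⊆Z)

      -- The pair `c`, `d` expresses the bound d/c on each of the covering stars without a division.
      scaled-card≤ : ∀ X → ∣ X ∣ ≤ r → (∀ Z → A Z ≡ true → t ≤ ∣ Z ∩ X ∣) →
                     ∀ c d → (∀ T → ∣ T ∣ ≡ t → c * # (in-star? T) ≤ d) →
                     c * card A ≤ (r C t) * d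
      scaled-card≤ X ∣X∣≤r meets c d bound = begin
        c * card A
          ≤⟨ *-monoʳ-≤ c (card≤∑choose X meets) ⟩
        c * ∑ (choose X t) (λ T → # (in-star? T))
          ≡⟨ ∑-* c (choose X t) (λ T → # (in-star? T)) ⟨
        ∑ (choose X t) (λ T → c * # (in-star? T))
          ≤⟨ ∑-mono (choose X t) (λ {T} T∈ → bound T (∈-choose⁻ X t T∈)) ⟩
        ∑ (choose X t) (λ _ → d)
          ≡⟨ ∑-const (choose X t) d ⟩
        length (choose X t) * d
          ≡⟨ cong (_* d) (length-choose X t) ⟩
        (∣ X ∣ C t) * d
          ≤⟨ *-monoˡ-≤ d (nCk-monoˡ-≤ t ∣X∣≤r) ⟩
        (r C t) * d ∎
        where open ≤-Reasoning

      -- Two savings are multiplied: one for the further point that `Y` forces into each set, and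
      -- one for the star of `T` inside `F`.
      in-star-not-through≤ : ∀ T Y → ∣ T ∣ ≡ t → ¬ T ⊆ Y → ∣ Y ∣ ≤ r →
        (∀ Z → A Z ≡ true → t ≤ ∣ Z ∩ Y ∣) → suc k * N * # (in-star? T) ≤ r * (r ∸ t) * card F
      in-star-not-through≤ T Y refl T⊈Y ∣Y∣≤r meets = begin
        suc k * N * # (in-star? T)
          ≡⟨ *-assoc (suc k) N _ ⟩
        suc k * (N * # (in-star? T))
          ≤⟨ *-monoʳ-≤ (suc k) (#-in-star≤ (in-star? T) T Y T⊈Y ∣Y∣≤r (in-star⊆ T)
               (λ X (AX , _) → meets X AX)) ⟩
        suc k * (r * (r ∸ t) * degree T)
          ≡⟨ rearrange (suc k) (r * (r ∸ t)) (degree T) ⟩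
        r * (r ∸ t) * (suc k * degree T)
          ≤⟨ *-monoʳ-≤ (r * (r ∸ t)) ([1+k]*degree≤ T refl) ⟩
        r * (r ∸ t) * card F ∎
        where
        open ≤-Reasoning
        rearrange : ∀ a b c → a * (b * c) ≡ b * (a * c)
        rearrange = solve-∀

      [1+k]*card≤-star : ∀ T → ∣ T ∣ ≡ t → (∀ X → A X ≡ true → T ⊆ X) → suc k * card A ≤ card F
      [1+k]*card≤-star T ∣T∣≡t A⊇T rewrite card≡# A =
        ≤-trans (*-monoʳ-≤ (suc k) (#-mono (_∈F? A) (star? T) (λ X AX → A⊆F X AX , A⊇T X AX)))
                ([1+k]*degree≤ T ∣T∣≡t)

      -- The set `X` is fixed and supplies the `r C t` stars, while `Y` may change with `T`. The
      -- total loss `(r C t) * r * (r ∸ t)` is outweighed by `N`.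
      [1+k]*card≤-no-star : ∀ X → ∣ X ∣ ≤ r → (∀ Z → A Z ≡ true → t ≤ ∣ Z ∩ X ∣) →
        (∀ T → ∣ T ∣ ≡ t → ∃ λ Y → ¬ T ⊆ Y × ∣ Y ∣ ≤ r × (∀ Z → A Z ≡ true → t ≤ ∣ Z ∩ Y ∣)) →
        suc k * card A ≤ card F
      [1+k]*card≤-no-star X ∣X∣≤r meets escape = *-cancelˡ-≤ N {{>-nonZero 1≤N}} (begin
        N * (suc k * card A)
          ≡⟨ rearrange N (suc k) (card A) ⟩
        suc k * N * card A
          ≤⟨ scaled-card≤ X ∣X∣≤r meets (suc k * N) (r * (r ∸ t) * card F)
               (λ T ∣T∣≡t → let Y , T⊈Y , ∣Y∣≤r , meetsY = escape T ∣T∣≡t in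
                  in-star-not-through≤ T Y ∣T∣≡t T⊈Y ∣Y∣≤r meetsY) ⟩
        (r C t) * (r * (r ∸ t) * card F)
          ≡⟨ rearrange′ (r C t) r (r ∸ t) (card F) ⟩
        (r ∸ t) * (r * (r C t)) * card F
          ≤⟨ *-monoˡ-≤ (card F) (*-monoˡ-≤ (r * (r C t)) (m≤m+n (r ∸ t) 1)) ⟩
        (r ∸ t + 1) * (r * (r C t)) * card F
          ≤⟨ *-monoˡ-≤ (card F) N-large ⟩
        N * card F ∎)
        where
        open ≤-Reasoning
        rearrange : ∀ a b c → a * (b * c) ≡ b * a * c
        rearrange = solve-∀
        rearrange′ : ∀ a b c d → a * (b * c * d) ≡ c * (b * a) * d
        rearrange′ = solve-∀

      -- A single star contains all of `A`, so the factor `r C t` in `N` is not spent on a cover. It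
      -- is at least 2 because `1 ≤ t < r`, which yields the extra factor 2.
      2[1+k]*card≤ : t < r → ∀ T Y → ∣ T ∣ ≡ t → (∀ X → A X ≡ true → T ⊆ X) →
        ¬ T ⊆ Y → ∣ Y ∣ ≤ r → (∀ Z → A Z ≡ true → t ≤ ∣ Z ∩ Y ∣) →
        suc k * (2 * card A) ≤ card F
      2[1+k]*card≤ t<r T Y ∣T∣≡t A⊇T T⊈Y ∣Y∣≤r meets = *-cancelˡ-≤ N {{>-nonZero 1≤N}} (begin
        N * (suc k * (2 * card A))
          ≡⟨ rearrange N (suc k) (card A) ⟩
        2 * (suc k * N * card A)
          ≤⟨ *-monoʳ-≤ 2 (*-monoʳ-≤ (suc k * N) card≤) ⟩
        2 * (suc k * N * # (in-star? T))
          ≤⟨ *-monoʳ-≤ 2 (in-star-not-through≤ T Y ∣T∣≡t T⊈Y ∣Y∣≤r meets) ⟩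
        2 * (r * (r ∸ t) * card F)
          ≡⟨ rearrange′ r (r ∸ t) (card F) ⟩
        (r ∸ t) * (r * 2) * card F
          ≤⟨ *-monoˡ-≤ (card F) (*-mono-≤ (m≤m+n (r ∸ t) 1) (*-monoʳ-≤ r (2≤nCk 1≤t t<r))) ⟩
        (r ∸ t + 1) * (r * (r C t)) * card F
          ≤⟨ *-monoˡ-≤ (card F) N-large ⟩
        N * card F ∎)
        where
        open ≤-Reasoning
        rearrange : ∀ a b c → a * (b * (2 * c)) ≡ 2 * (b * a * c)
        rearrange = solve-∀
        rearrange′ : ∀ a b c → 2 * (a * b * c) ≡ b * (a * 2) * c
        rearrange′ = solve-∀
        card≤ : card A ≤ # (in-star? T)
        card≤ rewrite card≡# A = #-mono (_∈F? A) (in-star? T) (λ X AX → AX , A⊇T X AX)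

      -- `A` is covered by `r C t` stars of `t`-sets, each holding at most the fraction 1/(2 C(r,
      -- t)) of `F`.
      2*card≤ : t < r → ∀ X → ∣ X ∣ ≤ r → (∀ Z → A Z ≡ true → t ≤ ∣ Z ∩ X ∣) → 2 * card A ≤ card F
      2*card≤ t<r X ∣X∣≤r meets = *-cancelˡ-≤ (r C t) {{>-nonZero (1≤nCk t≤r)}} (begin
        (r C t) * (2 * card A)
          ≡⟨ rearrange (r C t) (card A) ⟩
        2 * (r C t) * card A
          ≤⟨ scaled-card≤ X ∣X∣≤r meets (2 * (r C t)) (card F) (λ T ∣T∣≡t →
               ≤-trans (*-monoʳ-≤ (2 * (r C t)) (#-mono (in-star? T) (star? T) (in-star⊆ T)))
                       (2*nCt*degree≤ t<r T ∣T∣≡t)) ⟩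
        (r C t) * card F ∎)
        where
        open ≤-Reasoning
        rearrange : ∀ a b → a * (2 * b) ≡ 2 * a * b
        rearrange = solve-∀

-- Cardinalities of families

card-mono : ∀ {F G : Family n} → F ⊆F G → card F ≤ card G
card-mono {F = F} {G} F⊆G rewrite card≡# F | card≡# G = #-mono (_∈F? F) (_∈F? G) F⊆G

card-empty : ∀ {F : Family n} → EmptyF F → card F ≡ 0
card-empty {F = F} F≡∅ = trans (card≡# F) (#≡0 (_∈F? F) (λ X FX → contradiction (trans (sym FX) (F≡∅ X)) λ ()))

-- A member `X` of `G` missing from `F` could be added to `F` inside `G`, making `card F` strictly
-- smaller than `card G`.
card-full : ∀ {F G : Family n} → F ⊆F G → card F ≡ card G → F ≐F G
card-full {F = F} {G} F⊆G ∣F∣≡∣G∣ X with F X in FX | G X in GX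
... | true  | true  = refl
... | false | false = refl
... | true  | false = trans (sym (F⊆G X FX)) GX
... | false | true  = contradiction ∣F∣≡∣G∣ (<⇒≢ (begin-strict
  card F                     ≡⟨ card≡# F ⟩
  # (_∈F? F)                 <⟨ m<m+n (# (_∈F? F)) (1≤# only-X? refl) ⟩
  # (_∈F? F) + # only-X?     ≤⟨ #-disjoint (_∈F? F) only-X? (_∈F? G) F⊆G (λ where _ refl → GX)
                                  (λ where _ FX′ refl → contradiction (trans (sym FX′) FX) λ ()) ⟩
  # (_∈F? G)                 ≡⟨ card≡# G ⟨
  card G                     ∎))
  where
  open ≤-Reasoning
  only-X? : Decidable (_≡ X)
  only-X? Y = Vec.≡-dec Bool._≟_ Y X

card-cong : ∀ {F G : Family n} → F ≐F G → card F ≡ card G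
card-cong F≐G = ≤-antisym (card-mono (λ X FX → trans (sym (F≐G X)) FX))
                          (card-mono (λ X GX → trans (F≐G X) GX))

sumFin-card-single : ∀ {k} (A : Fin k → Family n) l → (∀ i → i ≢ l → EmptyF (A i)) →
                     sumFin (λ i → card (A i)) ≡ card (A l)
sumFin-card-single A l empty = sumFin-single l (λ i i≢l → card-empty (empty i i≢l))

-- Some member of the union B_l of the `A i` with `i ≢ l` satisfies `P`; the union itself is not
-- formed.
Others : ∀ {k} → (Fin k → Family n) → Fin k → (Subset n → Set) → Set
Others A l P = ∃ λ i → i ≢ l × ∃ λ X → A i X ≡ true × P X

others? : ∀ {k} (A : Fin k → Family n) l {P} → Decidable P → Dec (Others A l P)
others? A l P? =
  Fin.any? (λ i → ¬? (i Fin.≟ l) ×-dec anySubset? (λ X → (X ∈F? A i) ×-dec P? X))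

-- Strict inequality for at least two nonempty families

module _ {n t r k : ℕ} (1≤t : 1 ≤ t) (t≤r : t ≤ r)
         (H : Family n) (hereditary : Hereditary H) (μ-large : μ≥ H (nS r t))
         (k-large : ∀ B → IsBase H B → k * r ^ t ≤ (∣ B ∣ ∸ r) ^ t)
         (S : Fin k → ℕ → Bool) (S≤r : ∀ i s → S i s ≡ true → s ≤ r)
         (A : Fin k → Family n) (cross : CrossIntersecting t A)
         (A⊆F : ∀ i → A i ⊆F levelUnion H (S i))
         (j : Fin k) (j-max : ∀ i → card (levelUnion H (S i)) ≤ card (levelUnion H (S j))) where

  -- The hypothesis, that every B_l has a member, says that at least two of the `A i` are nonempty.
  sum-card-< : (∀ l → Others A l (λ _ → Unit)) →
               sumFin (λ i → card (A i)) < card (levelUnion H (S j))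
  sum-card-< others =
    -- One member of some `A i` shows both that `H` has a base and that `F j` is nonempty; the
    -- latter is needed for strictness.
    let i , _ , X , AX , _ = others j
        B , base , smallest = ∃-smallest-base H (proj₁ (levelUnion⁻ H (S i) X (A⊆F i X AX)))
        r≤∣B∣ = ≤-trans (m≤n+m r _) (μ-large B base)
        f≥1 = ≤-trans (≤-trans (1≤# (_∈F? F i) (A⊆F i X AX)) (≤-reflexive (sym (card≡# (F i)))))
                      (j-max i)
    -- With `B` a smallest base, the gap is μ(H) - r; the subtraction is exact since
    -- `r ≤ nS r t ≤ ∣ B ∣`.
    in WithGap.sum< (∣ B ∣ ∸ r) (λ D base′ → ≤-trans (≤-reflexive (m∸n+n≡m r≤∣B∣)) (smallest D base′))
          (k-large B base)
          (m+n≤o⇒m≤o∸n _ (≤-trans (nS-large r t) (μ-large B base)))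
          f≥1
    where
    F : Fin k → Family n
    F i = levelUnion H (S i)

    ∣A∣≤r : ∀ i X → A i X ≡ true → ∣ X ∣ ≤ r
    ∣A∣≤r i X AX = S≤r i ∣ X ∣ (proj₂ (levelUnion⁻ H (S i) X (A⊆F i X AX)))

    meets : ∀ {i l X} → i ≢ l → A i X ≡ true → ∀ Z → A l Z ≡ true → t ≤ ∣ Z ∩ X ∣
    meets {i} {l} {X} i≢l AX Z AZ = cross l i (i≢l ∘ sym) Z X AZ AX

    module WithGap (N : ℕ) (large : ∀ B → IsBase H B → N + r ≤ ∣ B ∣) (k*r^t≤N^t : k * r ^ t ≤ N ^ t)
                   (N-large : (r ∸ t + 1) * (r * (r C t)) ≤ N) (f≥1 : 1 ≤ card (F j)) where

      module Bd i = Stars.Bounds H hereditary r N large (S i) (S≤r i) t k 1≤t t≤r k*r^t≤N^t N-large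

      sum< : sumFin (λ i → card (A i)) < card (F j)
      -- Search for an index `l` and a `t`-set `T` whose star contains B_l.
      sum< with Fin.any? (λ l → anySubset? (λ T →
           (∣ T ∣ ≟ t) ×-dec ¬? (others? A l (λ X → ¬? (T ⊆? X)))))
      ... | no ¬star = sumFin-< (λ i → card (A i)) f≥1 (λ l →
        let i , i≢l , X , AX , _ = others l in
        ≤-trans (Bd.[1+k]*card≤-no-star l (A l) (A⊆F l) X (∣A∣≤r i X AX) (meets i≢l AX)
                   (λ T ∣T∣≡t →
                     let i , i≢l , Y , AY , T⊈Y =
                           decidable-stable (others? A l (λ X → ¬? (T ⊆? X)))
                             (λ ¬escape → ¬star (l , T , ∣T∣≡t , ¬escape))
                     in Y , T⊈Y , ∣A∣≤r i Y AY , meets i≢l AY))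
                (j-max l))
      ... | yes (l , T , ∣T∣≡t , ¬escape) = by-cases (anySubset? (λ X → (X ∈F? A l) ×-dec ¬? (T ⊆? X)))
        where
        A⊇T : ∀ i → i ≢ l → ∀ X → A i X ≡ true → T ⊆ X
        A⊇T i i≢l X AX = decidable-stable (T ⊆? X) (λ T⊈X → ¬escape (i , i≢l , X , AX , T⊈X))

        by-cases : Dec (∃ λ X → A l X ≡ true × ¬ T ⊆ X) → sumFin (λ i → card (A i)) < card (F j)
        by-cases (no ¬escape-l) = sumFin-< (λ i → card (A i)) f≥1 (λ i →
          ≤-trans (Bd.[1+k]*card≤-star i (A i) (A⊆F i) T ∣T∣≡t (all⊇T i)) (j-max i))
          where
          all⊇T : ∀ i X → A i X ≡ true → T ⊆ X
          all⊇T i X AX with i Fin.≟ l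
          ... | yes refl = decidable-stable (T ⊆? X) (λ T⊈X → ¬escape-l (X , AX , T⊈X))
          ... | no i≢l   = A⊇T i i≢l X AX
        by-cases (yes (X₀ , AX₀ , T⊈X₀)) =
          sumFin-<-except (λ i → card (A i)) l f≥1
            (let i , i≢l , Y , AY , _ = others l in
             ≤-trans (Bd.2*card≤ l (A l) (A⊆F l) t<r Y (∣A∣≤r i Y AY) (meets i≢l AY)) (j-max l))
            (λ i i≢l → ≤-trans
              (Bd.2[1+k]*card≤ i (A i) (A⊆F i) t<r T X₀ ∣T∣≡t (A⊇T i i≢l) T⊈X₀ (∣A∣≤r l X₀ AX₀)
                 (meets (i≢l ∘ sym) AX₀))
              (j-max i))
          where
          -- If r = t, the sets that contain T all equal T and hence cannot t-intersect X₀ ⊉ T.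
          t<r : t < r
          t<r = ≤∧≢⇒< t≤r λ where
            refl → let i , i≢l , Y , AY , _ = others l
                       Y⊆T : Y ⊆ T
                       Y⊆T = p⊆q∧∣q∣≤∣p∣⇒q⊆p (A⊇T i i≢l Y AY)
                               (≤-trans (∣A∣≤r i Y AY) (≤-reflexive (sym ∣T∣≡t)))
                       X₀∩Y⊆T : X₀ ∩ Y ⊆ T
                       X₀∩Y⊆T x∈ = Y⊆T (proj₂ (x∈p∩q⁻ X₀ Y x∈))
                       T⊆X₀∩Y : T ⊆ X₀ ∩ Y
                       T⊆X₀∩Y = p⊆q∧∣q∣≤∣p∣⇒q⊆p X₀∩Y⊆T
                                  (≤-trans (≤-reflexive ∣T∣≡t) (meets i≢l AY X₀ AX₀))
                   in T⊈X₀ (λ x∈T → proj₁ (x∈p∩q⁻ X₀ Y (T⊆X₀∩Y x∈T)))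

-- The bound μ(H) ≥ (k^(1/t) + 1) r is stated without roots: move `r` to the other side and take
-- `t`-th powers. The truncated subtraction is exact because `r ≤ nS r t`. Each S_i is given by its
-- characteristic function.
theorem2p6 : (n t r k : ℕ) → 1 ≤ t → t ≤ r → 2 ≤ k →
    (H : Family n) → Hereditary H →
    μ≥ H (nS r t) →
    ((B : Subset n) → IsBase H B → k * r ^ t ≤ (∣ B ∣ ∸ r) ^ t) →
    (S : Fin k → ℕ → Bool) →
    ((i : Fin k) → (s : ℕ) → S i s ≡ true → t ≤ s × s ≤ r) →
    ((i : Fin k) → ∃[ s ] S i s ≡ true) →
    (A : Fin k → Family n) →
    CrossIntersecting t A →
    ((i : Fin k) → A i ⊆F levelUnion H (S i)) →
    (j : Fin k) →
    ((i : Fin k) → card (levelUnion H (S i)) ≤ card (levelUnion H (S j))) →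
    (sumFin (λ i → card (A i)) ≤ card (levelUnion H (S j)))
    × ((sumFin (λ i → card (A i)) ≡ card (levelUnion H (S j)))
    ⇔ (∃[ l ] (card (levelUnion H (S l)) ≡ card (levelUnion H (S j))
    × (A l ≐F levelUnion H (S l))
    × ((i : Fin k) → ¬ (i ≡ l) → EmptyF (A i)))))
theorem2p6 n t r k 1≤t t≤r _ H hereditary μ-large k-large S S-range _ A cross A⊆F j j-max =
  -- Either all the families but one index `l` are empty, where `A l` may be empty too, or at least
  -- two are nonempty.
  let sum≤ , extremal = by-cases (Fin.any? (λ l → ¬? (others? A l (λ _ → yes tt)))) in
  sum≤ , mk⇔ extremal (λ (l , ∣Fl∣≡∣Fj∣ , Al≐Fl , empty) →
    trans (sumFin-card-single A l empty) (trans (card-cong Al≐Fl) ∣Fl∣≡∣Fj∣))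
  where
  F : Fin k → Family n
  F i = levelUnion H (S i)

  Extremal : Set
  Extremal = ∃[ l ] (card (F l) ≡ card (F j) × (A l ≐F F l) × ((i : Fin k) → ¬ (i ≡ l) → EmptyF (A i)))

  by-cases : Dec (∃ λ l → ¬ Others A l (λ _ → Unit)) →
             (sumFin (λ i → card (A i)) ≤ card (F j)) ×
             (sumFin (λ i → card (A i)) ≡ card (F j) → Extremal)
  by-cases (no ¬alone) =
    let sum< = sum-card-< 1≤t t≤r H hereditary μ-large k-large S
                 (λ i s Ss → proj₂ (S-range i s Ss)) A cross A⊆F j j-max
                 (λ l → decidable-stable (others? A l (λ _ → yes tt)) (λ alone → ¬alone (l , alone)))
    in <⇒≤ sum< , λ sum≡ → contradiction sum≡ (<⇒≢ sum<)
  by-cases (yes (l , alone)) =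
      ≤-trans (≤-reflexive sum≡) (≤-trans ∣Al∣≤∣Fl∣ (j-max l))
    , λ sum≡∣Fj∣ →
        -- Equality squeezes `card (F l)` between `card (A l)` and `card (F j)`.
        let ∣Al∣≡∣Fj∣ = trans (sym sum≡) sum≡∣Fj∣
            ∣Fl∣≡∣Fj∣ = ≤-antisym (j-max l) (≤-trans (≤-reflexive (sym ∣Al∣≡∣Fj∣)) ∣Al∣≤∣Fl∣)
        in l , ∣Fl∣≡∣Fj∣ , card-full (A⊆F l) (trans ∣Al∣≡∣Fj∣ (sym ∣Fl∣≡∣Fj∣)) , empty
    where
    empty : ∀ i → i ≢ l → EmptyF (A i)
    empty i i≢l X = ¬-not (λ AX → alone (i , i≢l , X , AX , tt))
    sum≡ : sumFin (λ i → card (A i)) ≡ card (A l)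
    sum≡ = sumFin-card-single A l empty
    ∣Al∣≤∣Fl∣ : card (A l) ≤ card (F l)
    ∣Al∣≤∣Fl∣ = card-mono (A⊆F l)
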